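{- Fix any $\gamma>0$. Consider the chain precedence graph $g\to r\to a\to b$ with the naive parent penalty $$V_{\mathrm{par}}(x)=x_r(1-x_g)+x_a(1-x_r)+x_b(1-x_a),\qquad x=(x_g,x_r,x_a,x_b).$$ Define $\hat f(x):=-w^\top x+\gamma V_{\mathrm{par}}(x)$ over $[0,1]^4$ with weights $w_g=w_r=-1$ and $w_a=w_b=1$. Then the infeasible binary point $x^\star=(0,0,1,1)$ is a strict local minimizer of $\hat f$ over $[0,1]^4$.
   Context: An arrow $p\to c$ is the precedence constraint $x_c\le x_p$ (block $p$ must be extracted before block $c$); a binary point is infeasible if it violates at least one of these constraints. A point $x^\star\in[0,1]^4$ is a strict local minimizer of $\hat f$ over $[0,1]^4$ if $\hat f(x)>\hat f(x^\star)$ for all $x\in[0,1]^4\setminus\{x^\star\}$ in some neighborhood of $x^\star$. -}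

module Defs where

open import Data.Fin using (Fin; zero; suc)
open import Data.List using (List; []; _∷_)
open import Data.List.Relation.Unary.Any using (Any)
open import Data.Nat as ℕ using (ℕ; _⊔_)
open import Data.Nat.Properties using (m⊔n≤o⇒m≤o; m⊔n≤o⇒n≤o)
import Data.Nat.Properties as ℕP
open import Data.Product using (∃; _×_; _,_)
open import Data.Rational as ℚ using (ℚ; 0ℚ; 1ℚ; ½; Positive)
open import Data.Rational.Properties as ℚP using (∣p+q∣≤∣p∣+∣q∣; ∣p*q∣≡∣p∣*∣q∣)
open import Data.Rational.Solver using (module +-*-Solver)
open import Data.Sum using (_⊎_; inj₁; inj₂)
open import Data.Vec.Functional using (Vector; zipWith; foldr)
open import Relation.Binary.PropositionalEquality
  using (_≡_; refl; sym; trans; cong; subst; subst₂)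
open import Relation.Nullary using (¬_)

------------------------------------------------------------------------
-- Real numbers: Cauchy sequences of rationals with the setoid equality
-- _≃_ (agda-stdlib has no real numbers).  The witness of Cauchy is a
-- modulus of convergence; rates are arbitrary, so every operation below
-- acts term by term.

Cauchy : (ℕ → ℚ) → Set
Cauchy s = ∀ ε → 0ℚ ℚ.< ε →
  ∃ λ N → ∀ m n → N ℕ.≤ m → N ℕ.≤ n → ℚ.∣ s m ℚ.- s n ∣ ℚ.< ε

record ℝ : Set where
  constructor mkℝ
  field
    seq    : ℕ → ℚ
    cauchy : Cauchy seq

open ℝ public

infix 4 _≃_ _≤_ _<_ _#_

_≃_ : ℝ → ℝ → Set
x ≃ y = ∀ ε → 0ℚ ℚ.< ε →
  ∃ λ N → ∀ n → N ℕ.≤ n → ℚ.∣ seq x n ℚ.- seq y n ∣ ℚ.< ε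

_≤_ : ℝ → ℝ → Set
x ≤ y = ∀ ε → 0ℚ ℚ.< ε →
  ∃ λ N → ∀ n → N ℕ.≤ n → seq x n ℚ.< seq y n ℚ.+ ε

_<_ : ℝ → ℝ → Set
x < y = ∃ λ ε → 0ℚ ℚ.< ε ×
  ∃ λ N → ∀ n → N ℕ.≤ n → seq x n ℚ.+ ε ℚ.< seq y n

-- Inequality of reals in its constructive form (apartness); classically
-- the same as ¬ (x ≃ y).
_#_ : ℝ → ℝ → Set
x # y = x < y ⊎ y < x

private
  open +-*-Solver

  +-interchange-- : ∀ x y u v →
    (x ℚ.- y) ℚ.+ (u ℚ.- v) ≡ (x ℚ.+ u) ℚ.- (y ℚ.+ v)
  +-interchange-- = solve 4
    (λ x y u v → (x :- y) :+ (u :- v) := (x :+ u) :- (y :+ v)) refl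

  *-difference : ∀ x y u v →
    x ℚ.* (u ℚ.- v) ℚ.+ v ℚ.* (x ℚ.- y) ≡ x ℚ.* u ℚ.- y ℚ.* v
  *-difference = solve 4
    (λ x y u v → x :* (u :- v) :+ v :* (x :- y) := x :* u :- y :* v) refl

  q+[p-q]≡p : ∀ p q → q ℚ.+ (p ℚ.- q) ≡ p
  q+[p-q]≡p = solve 2 (λ p q → q :+ (p :- q) := p) refl

  [p+q]-p≡q : ∀ p q → (p ℚ.+ q) ℚ.- p ≡ q
  [p+q]-p≡q = solve 2 (λ p q → (p :+ q) :- p := q) refl

  q-p≡-[p-q] : ∀ p q → q ℚ.- p ≡ ℚ.- (p ℚ.- q)
  q-p≡-[p-q] = solve 2 (λ p q → q :- p := :- (p :- q)) refl

  pos : ∀ {p} → 0ℚ ℚ.< p → Positive p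
  pos = ℚ.positive

  half-pos : ∀ {ε} → 0ℚ ℚ.< ε → 0ℚ ℚ.< ½ ℚ.* ε
  half-pos {ε} 0<ε =
    ℚP.positive⁻¹ _ {{ℚP.pos*pos⇒pos ½ ε {{pos 0<ε}}}}

  halves : ∀ ε → ½ ℚ.* ε ℚ.+ ½ ℚ.* ε ≡ ε
  halves ε = trans (sym (ℚP.*-distribʳ-+ ε ½ ½)) (ℚP.*-identityˡ ε)

  const-cauchy : ∀ q → Cauchy (λ _ → q)
  const-cauchy q ε 0<ε = 0 , λ _ _ _ _ →
    subst (ℚ._< ε) (sym (cong ℚ.∣_∣ (ℚP.+-inverseʳ q))) 0<ε

  +-cauchy : ∀ {s t} → Cauchy s → Cauchy t → Cauchy (λ n → s n ℚ.+ t n)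
  +-cauchy {s} {t} cs ct ε 0<ε
    with M , hs ← cs _ (half-pos 0<ε)
    with N , ht ← ct _ (half-pos 0<ε) = M ⊔ N , λ m n p q →
      subst₂ (λ u v → ℚ.∣ u ∣ ℚ.< v)
        (+-interchange-- (s m) (s n) (t m) (t n))
        (halves ε)
        (ℚP.≤-<-trans (∣p+q∣≤∣p∣+∣q∣ (s m ℚ.- s n) (t m ℚ.- t n))
          (ℚP.+-mono-<
            (hs m n (m⊔n≤o⇒m≤o M N p) (m⊔n≤o⇒m≤o M N q))
            (ht m n (m⊔n≤o⇒n≤o M N p) (m⊔n≤o⇒n≤o M N q))))

  neg-cauchy : ∀ {s} → Cauchy s → Cauchy (λ n → ℚ.- s n)
  neg-cauchy {s} cs ε 0<ε with M , hs ← cs ε 0<ε = M , λ m n p q →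
    subst (ℚ._< ε)
      (trans (sym (ℚP.∣-p∣≡∣p∣ (s m ℚ.- s n)))
        (cong ℚ.∣_∣ (ℚP.neg-distrib-+ (s m) (ℚ.- s n))))
      (hs m n p q)

  0≤∣_∣ : ∀ p → 0ℚ ℚ.≤ ℚ.∣ p ∣
  0≤∣ p ∣ = ℚP.nonNegative⁻¹ _ {{ℚP.∣-∣-nonNeg p}}

  ∣p∣≤∣q∣+∣p-q∣ : ∀ p q → ℚ.∣ p ∣ ℚ.≤ ℚ.∣ q ∣ ℚ.+ ℚ.∣ p ℚ.- q ∣
  ∣p∣≤∣q∣+∣p-q∣ p q =
    subst (λ u → ℚ.∣ u ∣ ℚ.≤ ℚ.∣ q ∣ ℚ.+ ℚ.∣ p ℚ.- q ∣)
      (q+[p-q]≡p p q)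
      (∣p+q∣≤∣p∣+∣q∣ q (p ℚ.- q))

  Bounded : (ℕ → ℚ) → Set
  Bounded u = ∃ λ A → 0ℚ ℚ.< A ×
    ∃ λ N → ∀ n → N ℕ.≤ n → ℚ.∣ u n ∣ ℚ.< A

  bounded : ∀ {s} → Cauchy s → Bounded s
  bounded {s} cs with N , h ← cs 1ℚ (ℚP.positive⁻¹ 1ℚ) =
    ℚ.∣ s N ∣ ℚ.+ 1ℚ ,
    ℚP.+-mono-≤-< 0≤∣ s N ∣ (ℚP.positive⁻¹ 1ℚ) ,
    N , λ n p → ℚP.≤-<-trans (∣p∣≤∣q∣+∣p-q∣ (s n) (s N))
      (ℚP.+-monoʳ-< ℚ.∣ s N ∣ (h n N p ℕP.≤-refl))

  ∣p*q∣< : ∀ {A η} p q → 0ℚ ℚ.< η →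
    ℚ.∣ p ∣ ℚ.< A → ℚ.∣ q ∣ ℚ.< η → ℚ.∣ p ℚ.* q ∣ ℚ.< A ℚ.* η
  ∣p*q∣< {A} {η} p q 0<η p< q< =
    subst (ℚ._< A ℚ.* η) (sym (∣p*q∣≡∣p∣*∣q∣ p q))
      (ℚP.≤-<-trans
        (ℚP.*-monoˡ-≤-nonNeg ℚ.∣ p ∣ {{ℚP.∣-∣-nonNeg p}} (ℚP.<⇒≤ q<))
        (ℚP.*-monoˡ-<-pos η {{pos 0<η}} p<))

  share : ∀ A B ε → 0ℚ ℚ.< A → 0ℚ ℚ.< B → 0ℚ ℚ.< ε →
    ∃ λ η → 0ℚ ℚ.< η × A ℚ.* η ℚ.+ B ℚ.* η ≡ ε
  share A B ε 0<A 0<B 0<ε =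
    split (A ℚ.+ B) refl (ℚP.pos+pos⇒pos A {{pos 0<A}} B {{pos 0<B}})
    where
    split : ∀ C → A ℚ.+ B ≡ C → Positive C →
      ∃ λ η → 0ℚ ℚ.< η × A ℚ.* η ℚ.+ B ℚ.* η ≡ ε
    split C A+B≡C C-pos = inv ((ℚ.1/ C) {{C≢0}})
      (ℚP.1/pos⇒pos C {{C-pos}}) (ℚP.*-inverseʳ C {{C≢0}})
      where
      C≢0 = ℚP.pos⇒nonZero C {{C-pos}}

      inv : ∀ D → Positive D → C ℚ.* D ≡ 1ℚ →
        ∃ λ η → 0ℚ ℚ.< η × A ℚ.* η ℚ.+ B ℚ.* η ≡ ε
      inv D D-pos CD≡1 = D ℚ.* ε ,
        ℚP.positive⁻¹ _ {{ℚP.pos*pos⇒pos D {{D-pos}} ε {{pos 0<ε}}}} ,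
        trans (sym (ℚP.*-distribʳ-+ (D ℚ.* ε) A B))
        (trans (cong (ℚ._* (D ℚ.* ε)) A+B≡C)
        (trans (sym (ℚP.*-assoc C D ε))
        (trans (cong (ℚ._* ε) CD≡1)
          (ℚP.*-identityˡ ε))))

  ∣xu-yv∣< : ∀ {A B η} x y u v → 0ℚ ℚ.< η →
    ℚ.∣ x ∣ ℚ.< A → ℚ.∣ v ∣ ℚ.< B →
    ℚ.∣ x ℚ.- y ∣ ℚ.< η → ℚ.∣ u ℚ.- v ∣ ℚ.< η →
    ℚ.∣ x ℚ.* u ℚ.- y ℚ.* v ∣ ℚ.< A ℚ.* η ℚ.+ B ℚ.* η
  ∣xu-yv∣< {A} {B} {η} x y u v 0<η x< v< x-y< u-v< =
    subst (λ z → ℚ.∣ z ∣ ℚ.< A ℚ.* η ℚ.+ B ℚ.* η) (*-difference x y u v)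
      (ℚP.≤-<-trans (∣p+q∣≤∣p∣+∣q∣ (x ℚ.* (u ℚ.- v)) (v ℚ.* (x ℚ.- y)))
        (ℚP.+-mono-< {_} {A ℚ.* η} {_} {B ℚ.* η}
          (∣p*q∣< x (u ℚ.- v) 0<η x< u-v<)
          (∣p*q∣< v (x ℚ.- y) 0<η v< x-y<)))

  *-cauchy : ∀ {s t} → Cauchy s → Cauchy t → Cauchy (λ n → s n ℚ.* t n)
  *-cauchy {s} {t} cs ct ε 0<ε = from-bounds (bounded cs) (bounded ct)
    where
    Close : (ℕ → ℚ) → ℚ → Set
    Close u η = ∃ λ N → ∀ m n → N ℕ.≤ m → N ℕ.≤ n →
      ℚ.∣ u m ℚ.- u n ∣ ℚ.< η

    from-bounds : Bounded s → Bounded t → Close (λ n → s n ℚ.* t n) ε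
    from-bounds (A , 0<A , K , hA) (B , 0<B , L , hB) =
      from-share (share A B ε 0<A 0<B 0<ε)
      where
      from-share : (∃ λ η → 0ℚ ℚ.< η × A ℚ.* η ℚ.+ B ℚ.* η ≡ ε) →
        Close (λ n → s n ℚ.* t n) ε
      from-share (η , 0<η , Aη+Bη≡ε) = from-close (cs η 0<η) (ct η 0<η)
        where
        from-close : Close s η → Close t η → Close (λ n → s n ℚ.* t n) ε
        from-close (M , hs) (N , ht) = (K ⊔ L) ⊔ (M ⊔ N) , λ m n p q →
          let p₁ = m⊔n≤o⇒m≤o (K ⊔ L) (M ⊔ N) p
              p₂ = m⊔n≤o⇒n≤o (K ⊔ L) (M ⊔ N) p
              q₁ = m⊔n≤o⇒m≤o (K ⊔ L) (M ⊔ N) q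
              q₂ = m⊔n≤o⇒n≤o (K ⊔ L) (M ⊔ N) q
          in subst (ℚ.∣ s m ℚ.* t m ℚ.- s n ℚ.* t n ∣ ℚ.<_) Aη+Bη≡ε
            (∣xu-yv∣< (s m) (s n) (t m) (t n) 0<η
              (hA m (m⊔n≤o⇒m≤o K L p₁)) (hB n (m⊔n≤o⇒n≤o K L q₁))
              (hs m n (m⊔n≤o⇒m≤o M N p₂) (m⊔n≤o⇒m≤o M N q₂))
              (ht m n (m⊔n≤o⇒n≤o M N p₂) (m⊔n≤o⇒n≤o M N q₂)))

  ∣p∣-∣q∣≤∣p-q∣ : ∀ p q → ℚ.∣ p ∣ ℚ.- ℚ.∣ q ∣ ℚ.≤ ℚ.∣ p ℚ.- q ∣
  ∣p∣-∣q∣≤∣p-q∣ p q =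
    subst (ℚ.∣ p ∣ ℚ.- ℚ.∣ q ∣ ℚ.≤_)
      ([p+q]-p≡q ℚ.∣ q ∣ ℚ.∣ p ℚ.- q ∣)
      (ℚP.+-monoˡ-≤ (ℚ.- ℚ.∣ q ∣) (∣p∣≤∣q∣+∣p-q∣ p q))

  ∣-∣-cauchy : ∀ {s} → Cauchy s → Cauchy (λ n → ℚ.∣ s n ∣)
  ∣-∣-cauchy {s} cs ε 0<ε with M , hs ← cs ε 0<ε = M , λ m n p q →
    let d = ℚ.∣ s m ∣ ℚ.- ℚ.∣ s n ∣ in
    case-abs d
      (ℚP.≤-<-trans (∣p∣-∣q∣≤∣p-q∣ (s m) (s n)) (hs m n p q))
      (subst (ℚ._< ε)
        (q-p≡-[p-q] ℚ.∣ s m ∣ ℚ.∣ s n ∣)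
        (ℚP.≤-<-trans (∣p∣-∣q∣≤∣p-q∣ (s n) (s m)) (hs n m q p)))
    where
    case-abs : ∀ d → d ℚ.< ε → ℚ.- d ℚ.< ε → ℚ.∣ d ∣ ℚ.< ε
    case-abs d d<ε -d<ε with ℚP.∣p∣≡p∨∣p∣≡-p d
    ... | inj₁ e = subst (ℚ._< ε) (sym e) d<ε
    ... | inj₂ e = subst (ℚ._< ε) (sym e) -d<ε

fromℚ : ℚ → ℝ
fromℚ q = mkℝ (λ _ → q) (const-cauchy q)

0ℝ 1ℝ : ℝ
0ℝ = fromℚ 0ℚ
1ℝ = fromℚ 1ℚ

infix  8 -_
infixl 7 _*_
infixl 6 _+_ _-_

_+_ : ℝ → ℝ → ℝ
x + y = mkℝ (λ n → seq x n ℚ.+ seq y n)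
  (+-cauchy {seq x} {seq y} (cauchy x) (cauchy y))

-_ : ℝ → ℝ
- x = mkℝ (λ n → ℚ.- seq x n) (neg-cauchy {seq x} (cauchy x))

_-_ : ℝ → ℝ → ℝ
x - y = x + (- y)

_*_ : ℝ → ℝ → ℝ
x * y = mkℝ (λ n → seq x n ℚ.* seq y n)
  (*-cauchy {seq x} {seq y} (cauchy x) (cauchy y))

∣_∣ : ℝ → ℝ
∣ x ∣ = mkℝ (λ n → ℚ.∣ seq x n ∣) (∣-∣-cauchy {seq x} (cauchy x))

------------------------------------------------------------------------
-- Strict local minimizers over the unit cube

InUnitCube : ∀ {k} → Vector ℝ k → Set
InUnitCube x = ∀ i → 0ℝ ≤ x i × x i ≤ 1ℝ

-- Neighbourhoods are taken in the sup norm, and x ≠ x⋆ is read as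
-- apartness in some coordinate.
IsStrictLocalMinimizer : ∀ {k} → (Vector ℝ k → ℝ) → Vector ℝ k → Set
IsStrictLocalMinimizer f x⋆ =
  InUnitCube x⋆ ×
  ∃ λ δ → 0ℝ < δ ×
    (∀ x → InUnitCube x → (∀ i → ∣ x i - x⋆ i ∣ < δ) →
      (∃ λ i → x i # x⋆ i) → f x⋆ < f x)

------------------------------------------------------------------------
-- Precedence graphs, as lists of arrows (p , c) from block p to block c

Graph : ℕ → Set
Graph k = List (Fin k × Fin k)

IsBinary : ∀ {k} → Vector ℝ k → Set
IsBinary x = ∀ i → x i ≃ 0ℝ ⊎ x i ≃ 1ℝ

ViolatesPrecedence : ∀ {k} → Graph k → Vector ℝ k → Set
ViolatesPrecedence G x = Any (λ (p , c) → ¬ (x c ≤ x p)) G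

IsInfeasibleBinary : ∀ {k} → Graph k → Vector ℝ k → Set
IsInfeasibleBinary G x = IsBinary x × ViolatesPrecedence G x

------------------------------------------------------------------------
-- The chain g → r → a → b

pattern g = zero
pattern r = suc zero
pattern a = suc (suc zero)
pattern b = suc (suc (suc zero))

chain : Graph 4
chain = (g , r) ∷ (r , a) ∷ (a , b) ∷ []

V-par : Vector ℝ 4 → ℝ
V-par x = x r * (1ℝ - x g) + x a * (1ℝ - x r) + x b * (1ℝ - x a)

infixl 7 _ᵀ_

_ᵀ_ : ∀ {k} → Vector ℝ k → Vector ℝ k → ℝ
w ᵀ x = foldr _+_ 0ℝ (zipWith _*_ w x)

w : Vector ℝ 4
w g = - 1ℝ
w r = - 1ℝ
w a = 1ℝ
w b = 1ℝ

f̂ : ℝ → Vector ℝ 4 → ℝ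
f̂ γ x = - (w ᵀ x) + γ * V-par x

x⋆ : Vector ℝ 4
x⋆ g = 0ℝ
x⋆ r = 0ℝ
x⋆ a = 1ℝ
x⋆ b = 1ℝ

{-# OPTIONS --safe #-}

-- In the deviations y = (x_g, x_r, 1 - x_a, 1 - x_b) ≥ 0 from x⋆,
--   f̂ x - f̂ x⋆ = (1 - γ y_r) y_g + y_r + (1 + γ (y_r - y_b)) y_a + y_b.
-- On the box ∣y_i∣ < δ with ∣γ∣ δ ≤ 1/4, all four weights lie in [1/2, 3/2],
-- so the sum is positive as soon as one y_i is.

module Submission where

open import Defs
open import Data.Fin using (Fin; zero; suc)
open import Data.Integer using (+_)
open import Data.List.Relation.Unary.Any using (here; there)
open import Data.Nat as ℕ using (ℕ; zero; suc; _⊔_)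
open import Data.Nat.Properties as ℕP using (m⊔n≤o⇒m≤o; m⊔n≤o⇒n≤o)
open import Data.Product using (∃; _×_; _,_; proj₁; proj₂)
open import Data.Rational as ℚ using (ℚ; 0ℚ; 1ℚ; ½; _/_)
open import Data.Rational.Properties as ℚP using (∣p+q∣≤∣p∣+∣q∣; ∣p*q∣≡∣p∣*∣q∣)
open import Data.Rational.Solver using (module +-*-Solver)
open import Data.Sum using (inj₁; inj₂)
open import Data.Vec.Functional using (Vector)
open import Function using (_∘_)
open import Relation.Binary.PropositionalEquality
open import Relation.Nullary using (¬_; contradiction)
open import Relation.Nullary.Decidable using (from-yes)

open +-*-Solver

-- Properties that hold at all large indices.

Eventually : (ℕ → Set) → Set
Eventually P = ∃ λ N → ∀ n → N ℕ.≤ n → P n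

private variable
  P Q : ℕ → Set

Eventually-map : (∀ n → P n → Q n) → Eventually P → Eventually Q
Eventually-map f (N , p) = N , λ n N≤n → f n (p n N≤n)

Eventually-zip : Eventually P → Eventually Q → Eventually (λ n → P n × Q n)
Eventually-zip (M , p) (N , q) =
  M ⊔ N , λ n M⊔N≤n → p n (m⊔n≤o⇒m≤o M N M⊔N≤n) , q n (m⊔n≤o⇒n≤o M N M⊔N≤n)

Eventually-∀ : ∀ {k} {R : Fin k → ℕ → Set} →
  (∀ i → Eventually (R i)) → Eventually (λ n → ∀ i → R i n)
Eventually-∀ {zero}  _ = 0 , λ _ _ ()
Eventually-∀ {suc k} h =
  Eventually-map (λ _ (p , q) → λ { zero → p ; (suc i) → q i })
    (Eventually-zip (h zero) (Eventually-∀ (h ∘ suc)))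

Eventually-inhabited : Eventually P → ∃ P
Eventually-inhabited (N , p) = N , p N ℕP.≤-refl

-- Absolute values in `ℚ` and the order on Cauchy reals.

p≤∣p∣ : ∀ p → p ℚ.≤ ℚ.∣ p ∣
p≤∣p∣ p with ℚP.≤-total 0ℚ p
... | inj₁ 0≤p = ℚP.≤-reflexive (sym (ℚP.0≤p⇒∣p∣≡p 0≤p))
... | inj₂ p≤0 = ℚP.≤-trans p≤0 (ℚP.0≤∣p∣ p)

-p≤∣p∣ : ∀ p → ℚ.- p ℚ.≤ ℚ.∣ p ∣
-p≤∣p∣ p = subst (ℚ.- p ℚ.≤_) (ℚP.∣-p∣≡∣p∣ p) (p≤∣p∣ (ℚ.- p))

∣p-q∣≡∣q-p∣ : ∀ p q → ℚ.∣ p ℚ.- q ∣ ≡ ℚ.∣ q ℚ.- p ∣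
∣p-q∣≡∣q-p∣ p q = trans (sym (ℚP.∣-p∣≡∣p∣ (p ℚ.- q)))
  (cong ℚ.∣_∣ (solve 2 (λ p q → :- (p :- q) := q :- p) refl p q))

≃-refl : ∀ x → x ≃ x
≃-refl x ε 0<ε =
  0 , λ n _ → subst (ℚ._< ε) (sym (cong ℚ.∣_∣ (ℚP.+-inverseʳ (seq x n)))) 0<ε

-- The gap `ε` of `y < x` serves as the tolerance in `x ≤ y`; the two bounds then clash at a single
-- common index.
≤⇒≯ : ∀ {x y} → x ≤ y → ¬ (y < x)
≤⇒≯ x≤y (ε , 0<ε , y+ε<x)
  with n , x<y+ε , y+ε<x ← Eventually-inhabited (Eventually-zip (x≤y ε 0<ε) y+ε<x) =
  ℚP.<-asym x<y+ε y+ε<x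

<⇒Eventually-< : ∀ {x y} → x < y → Eventually (λ n → seq x n ℚ.< seq y n)
<⇒Eventually-< {x} (ε , 0<ε , h) = Eventually-map
  (λ n → ℚP.<-trans
    (subst (ℚ._< seq x n ℚ.+ ε) (ℚP.+-identityʳ (seq x n))
      (ℚP.+-monoʳ-< (seq x n) 0<ε)))
  h

≤⇒0≤- : ∀ {x y} → x ≤ y → 0ℝ ≤ y - x
≤⇒0≤- {x} {y} x≤y ε 0<ε = Eventually-map
  (λ n x<y+ε → subst₂ ℚ._<_ (ℚP.+-inverseʳ (seq x n))
    (solve 3 (λ x y ε → y :+ ε :- x := y :- x :+ ε) refl (seq x n) (seq y n) ε)
    (ℚP.+-monoˡ-< (ℚ.- seq x n) x<y+ε))
  (x≤y ε 0<ε)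

<⇒0<- : ∀ {x y} → x < y → 0ℝ < y - x
<⇒0<- {x} {y} (ε , 0<ε , h) = ε , 0<ε , Eventually-map
  (λ n x+ε<y → subst (ℚ._< seq y n ℚ.- seq x n)
    (solve 2 (λ x ε → x :+ ε :- x := con 0ℚ :+ ε) refl (seq x n) ε)
    (ℚP.+-monoˡ-< (ℚ.- seq x n) x+ε<y))
  h

fromℚ-mono-≤ : ∀ {p q} → p ℚ.≤ q → fromℚ p ≤ fromℚ q
fromℚ-mono-≤ {p} {q} p≤q ε 0<ε = 0 , λ _ _ →
  subst (ℚ._< q ℚ.+ ε) (ℚP.+-identityʳ p) (ℚP.+-mono-≤-< p≤q 0<ε)

0<½ : 0ℚ ℚ.< ½
0<½ = ℚP.positive⁻¹ ½

fromℚ-mono-< : ∀ {p q} → p ℚ.< q → fromℚ p < fromℚ q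
-- The gap in `_<_` must leave strict room, so `q - p` itself is too large; `m - p` for an
-- intermediate `m` works.
fromℚ-mono-< {p} {q} p<q with m , p<m , m<q ← ℚP.<-dense p<q =
  m ℚ.- p ,
  subst (ℚ._< m ℚ.- p) (ℚP.+-inverseʳ p) (ℚP.+-monoˡ-< (ℚ.- p) p<m) ,
  0 , λ _ _ → subst (ℚ._< q) (solve 2 (λ p m → m := p :+ (m :- p)) refl p m) m<q

-- Beyond the modulus for tolerance 1, all terms lie within 1 of `seq x N`. Applied to `γ`, this
-- gives a rational bound from which one radius can be chosen for all large indices.
eventually-bounded : ∀ x →
  ∃ λ A → ℚ.Positive A × Eventually (λ n → ℚ.∣ seq x n ∣ ℚ.≤ A)
eventually-bounded x with N , h ← cauchy x 1ℚ (ℚP.positive⁻¹ 1ℚ) =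
  ℚ.∣ seq x N ∣ ℚ.+ 1ℚ ,
  ℚ.positive (ℚP.+-mono-≤-< (ℚP.0≤∣p∣ (seq x N)) (ℚP.positive⁻¹ 1ℚ)) ,
  N , λ n N≤n → begin
    ℚ.∣ seq x n ∣
      ≡⟨ cong ℚ.∣_∣ (solve 2 (λ p q → p := q :+ (p :- q)) refl (seq x n) (seq x N)) ⟩
    ℚ.∣ seq x N ℚ.+ (seq x n ℚ.- seq x N) ∣
      ≤⟨ ∣p+q∣≤∣p∣+∣q∣ (seq x N) (seq x n ℚ.- seq x N) ⟩
    ℚ.∣ seq x N ∣ ℚ.+ ℚ.∣ seq x n ℚ.- seq x N ∣
      ≤⟨ ℚP.+-monoʳ-≤ ℚ.∣ seq x N ∣ (ℚP.<⇒≤ (h n N N≤n ℕP.≤-refl)) ⟩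
    ℚ.∣ seq x N ∣ ℚ.+ 1ℚ ∎
  where open ℚP.≤-Reasoning

¼ 1/24 3/2 : ℚ
¼    = + 1 / 4
1/24 = + 1 / 24
3/2  = + 3 / 2

0<p*q : ∀ p {q} .{{_ : ℚ.Positive p}} → 0ℚ ℚ.< q → 0ℚ ℚ.< p ℚ.* q
0<p*q p {q} 0<q = ℚP.positive⁻¹ _ {{ℚP.pos*pos⇒pos p q {{ℚ.positive 0<q}}}}

positive-quotient : ∀ p A → ℚ.Positive p → ℚ.Positive A →
  ∃ λ δ → 0ℚ ℚ.< δ × A ℚ.* δ ≡ p
positive-quotient p A p-pos A-pos =
  A⁻¹ ℚ.* p ,
  ℚP.positive⁻¹ _ {{ℚP.pos*pos⇒pos A⁻¹ {{ℚP.1/pos⇒pos A {{A-pos}}}} p {{p-pos}}}} ,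
  trans (sym (ℚP.*-assoc A A⁻¹ p))
    (trans (cong (ℚ._* p) (ℚP.*-inverseʳ A {{A≢0}})) (ℚP.*-identityˡ p))
  where
  A≢0 = ℚP.pos⇒nonZero A {{A-pos}}
  A⁻¹ = (ℚ.1/ A) {{A≢0}}

∣p*q∣≤ : ∀ {A B} p q → ℚ.∣ p ∣ ℚ.≤ A → ℚ.∣ q ∣ ℚ.≤ B → ℚ.∣ p ℚ.* q ∣ ℚ.≤ A ℚ.* B
∣p*q∣≤ {A} {B} p q ∣p∣≤A ∣q∣≤B = begin
  ℚ.∣ p ℚ.* q ∣       ≡⟨ ∣p*q∣≡∣p∣*∣q∣ p q ⟩
  ℚ.∣ p ∣ ℚ.* ℚ.∣ q ∣ ≤⟨ ℚP.*-monoʳ-≤-nonNeg ℚ.∣ q ∣ {{ℚP.∣-∣-nonNeg q}} ∣p∣≤A ⟩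
  A ℚ.* ℚ.∣ q ∣       ≤⟨ ℚP.*-monoˡ-≤-nonNeg A {{A-nonNeg}} ∣q∣≤B ⟩
  A ℚ.* B             ∎
  where
  open ℚP.≤-Reasoning
  A-nonNeg : ℚ.NonNegative A
  A-nonNeg = ℚ.nonNegative (ℚP.≤-trans (ℚP.0≤∣p∣ p) ∣p∣≤A)

-- Sums with coefficients between `½` and `3/2`.

record Weight (c : ℚ) : Set where
  constructor mkWeight
  field
    lower : ½ ℚ.≤ c
    upper : c ℚ.≤ 3/2

  nonNegative : ℚ.NonNegative c
  nonNegative = ℚ.nonNegative (ℚP.≤-trans (ℚP.<⇒≤ 0<½) lower)

open Weight

weight-1+ : ∀ d → ℚ.∣ d ∣ ℚ.≤ ½ → Weight (1ℚ ℚ.+ d)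
weight-1+ d ∣d∣≤½ = mkWeight
  (subst (λ z → 1ℚ ℚ.- ½ ℚ.≤ 1ℚ ℚ.+ z) (solve 1 (λ d → :- (:- d) := d) refl d)
    (ℚP.+-monoʳ-≤ 1ℚ (ℚP.neg-antimono-≤ (ℚP.≤-trans (-p≤∣p∣ d) ∣d∣≤½))))
  (ℚP.+-monoʳ-≤ 1ℚ (ℚP.≤-trans (p≤∣p∣ d) ∣d∣≤½))

-- Approximants of a nonnegative real may be slightly negative. The upper bound on the weight limits
-- the resulting loss, with no case split on the sign of `y`.
weighted-≥ : ∀ {c y η} → Weight c → 0ℚ ℚ.< η → 0ℚ ℚ.< y ℚ.+ η →
  ℚ.- (3/2 ℚ.* η) ℚ.≤ c ℚ.* y
weighted-≥ {c} {y} {η} wc 0<η 0<y+η = begin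
  ℚ.- (3/2 ℚ.* η)
    ≤⟨ ℚP.neg-antimono-≤
         (ℚP.*-monoʳ-≤-nonNeg η {{ℚ.nonNegative (ℚP.<⇒≤ 0<η)}} (upper wc)) ⟩
  ℚ.- (c ℚ.* η)
    ≡⟨ solve 2 (λ c η → :- (c :* η) := c :* (con 0ℚ :- η)) refl c η ⟩
  c ℚ.* (0ℚ ℚ.- η)
    ≤⟨ ℚP.*-monoˡ-≤-nonNeg c {{nonNegative wc}}
         (ℚP.+-monoˡ-≤ (ℚ.- η) (ℚP.<⇒≤ 0<y+η)) ⟩
  c ℚ.* (y ℚ.+ η ℚ.- η)
    ≡⟨ solve 3 (λ c y η → c :* (y :+ η :- η) := c :* y) refl c y η ⟩
  c ℚ.* y ∎
  where open ℚP.≤-Reasoning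

weighted-> : ∀ {c y ε} → Weight c → 0ℚ ℚ.< ε → ε ℚ.< y → ½ ℚ.* ε ℚ.< c ℚ.* y
weighted-> {c} {y} {ε} wc 0<ε ε<y = begin-strict
  ½ ℚ.* ε <⟨ ℚP.*-monoʳ-<-pos ½ ε<y ⟩
  ½ ℚ.* y ≤⟨ ℚP.*-monoʳ-≤-nonNeg y
               {{ℚ.nonNegative (ℚP.<⇒≤ (ℚP.<-trans 0<ε ε<y))}} (lower wc) ⟩
  c ℚ.* y ∎
  where open ℚP.≤-Reasoning

sum₄ : Vector ℚ 4 → ℚ
sum₄ z = z g ℚ.+ z r ℚ.+ z a ℚ.+ z b

-- Strictness enters at summand `j` and the other three contribute their weak bounds; the cases
-- differ only in the position of `h`.
sum₄-> : ∀ {l h} z j → (∀ i → l ℚ.≤ z i) → h ℚ.< z j →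
  h ℚ.+ l ℚ.+ l ℚ.+ l ℚ.< sum₄ z
sum₄-> z g l≤z h<z =
  ℚP.+-mono-<-≤ (ℚP.+-mono-<-≤ (ℚP.+-mono-<-≤ h<z (l≤z r)) (l≤z a)) (l≤z b)
sum₄-> {l} {h} z r l≤z h<z = subst (ℚ._< sum₄ z)
  (solve 2 (λ l h → l :+ h :+ l :+ l := h :+ l :+ l :+ l) refl l h)
  (ℚP.+-mono-<-≤ (ℚP.+-mono-<-≤ (ℚP.+-mono-≤-< (l≤z g) h<z) (l≤z a)) (l≤z b))
sum₄-> {l} {h} z a l≤z h<z = subst (ℚ._< sum₄ z)
  (solve 2 (λ l h → l :+ l :+ h :+ l := h :+ l :+ l :+ l) refl l h)
  (ℚP.+-mono-<-≤ (ℚP.+-mono-≤-< (ℚP.+-mono-≤ (l≤z g) (l≤z r)) h<z) (l≤z b))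
sum₄-> {l} {h} z b l≤z h<z = subst (ℚ._< sum₄ z)
  (solve 2 (λ l h → l :+ l :+ l :+ h := h :+ l :+ l :+ l) refl l h)
  (ℚP.+-mono-≤-< (ℚP.+-mono-≤ (ℚP.+-mono-≤ (l≤z g) (l≤z r)) (l≤z a)) h<z)

-- Each mixed product is charged to its factor `y g` or `y a`, which leaves `y r` and `y b` with
-- coefficient exactly 1.
weights : ℚ → Vector ℚ 4 → Vector ℚ 4
weights γ y g = 1ℚ ℚ.+ ℚ.- (γ ℚ.* y r)
weights γ y r = 1ℚ
weights γ y a = 1ℚ ℚ.+ (γ ℚ.* y r ℚ.- γ ℚ.* y b)
weights γ y b = 1ℚ

-- The threshold `¼` is dictated by coordinate `a`: its weight deviates from 1 by two terms, which
-- together may use up the whole allowance `½`.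
weights-Weight : ∀ γ y → (∀ i → ℚ.∣ γ ℚ.* y i ∣ ℚ.≤ ¼) → ∀ i → Weight (weights γ y i)
weights-Weight γ y h = λ where
    g → weight-1+ (ℚ.- (γ ℚ.* y r)) (begin
      ℚ.∣ ℚ.- (γ ℚ.* y r) ∣ ≡⟨ ℚP.∣-p∣≡∣p∣ (γ ℚ.* y r) ⟩
      ℚ.∣ γ ℚ.* y r ∣       ≤⟨ h r ⟩
      ¼                     ≤⟨ from-yes (¼ ℚP.≤? ½) ⟩
      ½                     ∎)
    -- `1ℚ ℚ.+ 0ℚ` computes to `1ℚ`.
    r → weight-1+ 0ℚ (ℚP.<⇒≤ 0<½)
    a → weight-1+ (γ ℚ.* y r ℚ.- γ ℚ.* y b) (begin
      ℚ.∣ γ ℚ.* y r ℚ.- γ ℚ.* y b ∣         ≤⟨ ℚP.∣p-q∣≤∣p∣+∣q∣ (γ ℚ.* y r) (γ ℚ.* y b) ⟩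
      ℚ.∣ γ ℚ.* y r ∣ ℚ.+ ℚ.∣ γ ℚ.* y b ∣   ≤⟨ ℚP.+-mono-≤ (h r) (h b) ⟩
      ½                                     ∎)
    b → weight-1+ 0ℚ (ℚP.<⇒≤ 0<½)
  where open ℚP.≤-Reasoning

-- Deviations from `x⋆` and the expansion of `f̂`.

deviation : Vector ℝ 4 → Vector ℝ 4
deviation x g = x g - x⋆ g
deviation x r = x r - x⋆ r
deviation x a = x⋆ a - x a
deviation x b = x⋆ b - x b

deviation-nonNeg : ∀ {x} → InUnitCube x → ∀ i → 0ℝ ≤ deviation x i
deviation-nonNeg {x} x∈ g = ≤⇒0≤- {0ℝ} {x g} (proj₁ (x∈ g))
deviation-nonNeg {x} x∈ r = ≤⇒0≤- {0ℝ} {x r} (proj₁ (x∈ r))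
deviation-nonNeg {x} x∈ a = ≤⇒0≤- {x a} {1ℝ} (proj₂ (x∈ a))
deviation-nonNeg {x} x∈ b = ≤⇒0≤- {x b} {1ℝ} (proj₂ (x∈ b))

-- The bound on `x` rules out one direction of apartness; the other carries an explicit rational
-- gap, which later drives the growth of `f̂`.
#-lower : ∀ {x y} → y ≤ x → x # y → 0ℝ < x - y
#-lower {x} {y} y≤x (inj₁ x<y) = contradiction x<y (≤⇒≯ {y} {x} y≤x)
#-lower {x} {y} y≤x (inj₂ y<x) = <⇒0<- {y} {x} y<x

#-upper : ∀ {x y} → x ≤ y → x # y → 0ℝ < y - x
#-upper {x} {y} x≤y (inj₁ x<y) = <⇒0<- {x} {y} x<y
#-upper {x} {y} x≤y (inj₂ y<x) = contradiction y<x (≤⇒≯ {x} {y} x≤y)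

deviation-pos : ∀ {x} → InUnitCube x → ∀ i → x i # x⋆ i → 0ℝ < deviation x i
deviation-pos {x} x∈ g = #-lower {x g} {0ℝ} (proj₁ (x∈ g))
deviation-pos {x} x∈ r = #-lower {x r} {0ℝ} (proj₁ (x∈ r))
deviation-pos {x} x∈ a = #-upper {x a} {1ℝ} (proj₂ (x∈ a))
deviation-pos {x} x∈ b = #-upper {x b} {1ℝ} (proj₂ (x∈ b))

∣deviation∣ : ∀ x n i → seq ∣ x i - x⋆ i ∣ n ≡ ℚ.∣ seq (deviation x i) n ∣
∣deviation∣ x n g = refl
∣deviation∣ x n r = refl
∣deviation∣ x n a = ∣p-q∣≡∣q-p∣ (seq (x a) n) 1ℚ
∣deviation∣ x n b = ∣p-q∣≡∣q-p∣ (seq (x b) n) 1ℚ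

weighted-deviations : ℝ → Vector ℝ 4 → ℕ → Vector ℚ 4
weighted-deviations γ x n i = weights (seq γ n) y i ℚ.* y i
  where
  y : Vector ℚ 4
  y j = seq (deviation x j) n

-- The first-order terms of `V-par` at `x⋆` cancel: it equals `1 - y_r y_g + y_r y_a - y_a y_b`.
-- Hence, apart from the constant, `γ` multiplies only products of two deviations, and these are
-- dominated near `x⋆` by the linear part `y_g + y_r + y_a + y_b`.
f̂-expansion : ∀ γ x n →
  seq (f̂ γ x) n ≡ seq (f̂ γ x⋆) n ℚ.+ sum₄ (weighted-deviations γ x n)
f̂-expansion γ x n = solve 5
  (λ γ xg xr xa xb →
    let 0' = con 0ℚ
        1' = con 1ℚ
        f = λ xg xr xa xb →
          -- The nesting and the final `0'` copy the unfolding of the `foldr` in `_ᵀ_`.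
          :- (:- 1' :* xg :+ (:- 1' :* xr :+ (1' :* xa :+ (1' :* xb :+ 0'))))
          :+ γ :* (xr :* (1' :- xg) :+ xa :* (1' :- xr) :+ xb :* (1' :- xa))
        yg = xg :- 0'
        yr = xr :- 0'
        ya = 1' :- xa
        yb = 1' :- xb
    in f xg xr xa xb := f 0' 0' 1' 1' :+
      ((1' :+ :- (γ :* yr)) :* yg :+ 1' :* yr
        :+ (1' :+ (γ :* yr :- γ :* yb)) :* ya :+ 1' :* yb))
  refl (seq γ n) (seq (x g) n) (seq (x r) n) (seq (x a) n) (seq (x b) n)

-- With η = ε/24 the margin is ε/2 - 3 (3/2 η) = 5/16 ε.
margin : ∀ ε → let l = ℚ.- (3/2 ℚ.* (1/24 ℚ.* ε)) in
  ½ ℚ.* ε ℚ.+ l ℚ.+ l ℚ.+ l ≡ (+ 5 / 16) ℚ.* ε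
margin = solve 1
  (λ ε → let l = :- (con 3/2 :* (con 1/24 :* ε)) in
    con ½ :* ε :+ l :+ l :+ l := con (+ 5 / 16) :* ε)
  refl

-- This is the estimate at a single index, with `γ` and `y` rational. Its lower bound depends on `ε`
-- alone, so it provides the uniform gap that `_<_` on reals demands.
weighted-sum-> : ∀ γ y j ε → 0ℚ ℚ.< ε →
  (∀ i → ℚ.∣ γ ℚ.* y i ∣ ℚ.≤ ¼) →
  (∀ i → 0ℚ ℚ.< y i ℚ.+ 1/24 ℚ.* ε) →
  ε ℚ.< y j →
  (+ 5 / 16) ℚ.* ε ℚ.< sum₄ (λ i → weights γ y i ℚ.* y i)
weighted-sum-> γ y j ε 0<ε small nonNeg large =
  subst (ℚ._< sum₄ (λ i → weights γ y i ℚ.* y i)) (margin ε)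
    (sum₄-> (λ i → weights γ y i ℚ.* y i) j
      (λ i → weighted-≥ (ws i) 0<η (nonNeg i))
      (weighted-> (ws j) 0<ε large))
  where
  0<η : 0ℚ ℚ.< 1/24 ℚ.* ε
  0<η = 0<p*q 1/24 0<ε
  ws = weights-Weight γ y small

growth : ∀ γ x n {d} → d ℚ.< sum₄ (weighted-deviations γ x n) →
  seq (f̂ γ x⋆) n ℚ.+ d ℚ.< seq (f̂ γ x) n
growth γ x n {d} d<Σ = subst (seq (f̂ γ x⋆) n ℚ.+ d ℚ.<_) (sym (f̂-expansion γ x n))
  (ℚP.+-monoʳ-< (seq (f̂ γ x⋆) n) d<Σ)

-- Infeasibility and strict local minimality of `x⋆`.

x⋆-infeasible : IsInfeasibleBinary chain x⋆
x⋆-infeasible =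
  (λ where
    g → inj₁ (≃-refl 0ℝ)
    r → inj₁ (≃-refl 0ℝ)
    a → inj₂ (≃-refl 1ℝ)
    b → inj₂ (≃-refl 1ℝ)) ,
  -- The violated arrow is the second one, `(r , a)`.
  there (here λ 1≤0 → ≤⇒≯ {1ℝ} {0ℝ} 1≤0 (fromℚ-mono-< (ℚP.positive⁻¹ 1ℚ)))

x⋆∈cube : InUnitCube x⋆
x⋆∈cube = λ where
    g → 0≤0 , 0≤1
    r → 0≤0 , 0≤1
    a → 0≤1 , 1≤1
    b → 0≤1 , 1≤1
  where
  0≤0 = fromℚ-mono-≤ {0ℚ} ℚP.≤-refl
  0≤1 = fromℚ-mono-≤ (ℚP.<⇒≤ (ℚP.positive⁻¹ 1ℚ))
  1≤1 = fromℚ-mono-≤ {1ℚ} ℚP.≤-refl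

x⋆-minimizer : ∀ γ → IsStrictLocalMinimizer (f̂ γ) x⋆
x⋆-minimizer γ =
  let A , A-pos , γ-bounded = eventually-bounded γ
      -- With `A` an eventual bound of `∣γ∣`, this radius forces `∣γ y_i∣ ≤ ¼` on the box at all
      -- large indices.
      δ , 0<δ , Aδ≡¼ = positive-quotient ¼ A _ A-pos
  in x⋆∈cube , fromℚ δ , fromℚ-mono-< 0<δ , λ x x∈ near (j , xj#) →
    -- `ε` is the gap of the coordinate `j` in which `x` is apart from `x⋆`; it depends on `x`,
    -- whereas `δ` was fixed beforehand.
    let ε , 0<ε , large = deviation-pos {x} x∈ j xj#
    in (+ 5 / 16) ℚ.* ε ,
      0<p*q (+ 5 / 16) 0<ε ,
      Eventually-map
        (λ n (∣γ∣≤A , nearₙ , nonNeg , largeₙ) → growth γ x n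
          (weighted-sum-> (seq γ n) (λ i → seq (deviation x i) n) j ε 0<ε
          (λ i → subst (ℚ.∣ seq γ n ℚ.* seq (deviation x i) n ∣ ℚ.≤_) Aδ≡¼
            (∣p*q∣≤ (seq γ n) (seq (deviation x i) n) ∣γ∣≤A
              (ℚP.<⇒≤ (subst (ℚ._< δ) (∣deviation∣ x n i) (nearₙ i)))))
          nonNeg
          (subst (ℚ._< seq (deviation x j) n) (ℚP.+-identityˡ ε) largeₙ)))
        (Eventually-zip γ-bounded
        (Eventually-zip
          (Eventually-∀ λ i → <⇒Eventually-< {∣ x i - x⋆ i ∣} {fromℚ δ} (near i))
        (Eventually-zip
          -- The tolerance for nonnegativity is tied to the gap at `j`, so the possible losses stay
          -- below the gain there.
          (Eventually-∀ λ i → deviation-nonNeg {x} x∈ i (1/24 ℚ.* ε)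
            (0<p*q 1/24 0<ε))
          large)))

lemma3p3 : (γ : ℝ) → 0ℝ < γ →
    IsInfeasibleBinary chain x⋆ × IsStrictLocalMinimizer (f̂ γ) x⋆
lemma3p3 γ _ = x⋆-infeasible , x⋆-minimizer γ
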